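{- If $G$ and $H$ are compatibly almost opposable finite simple graphs, then the strong product $G\boxtimes H$ is compatibly almost opposable.
   Context: All graphs are finite and simple. $N[v]$ denotes the closed neighbourhood of $v$. "Automorphism of order two" means an automorphism $f$ with $f\circ f=\mathrm{id}$. An opposition of a graph $G$ is an automorphism $f$ of $G$ of order two such that $f(v)\notin N[v]$ for all $v\in V(G)$. A graph is opposable if it has an opposition (the empty graph is vacuously opposable). A set $S\subseteq V(G)$ is admissible if $u\in S\subseteq N[u]$ for some $u\in V(G)$. The graph $G$ is almost opposable if there is an admissible set $S$ such that $G-S$ is opposable. For an almost opposable graph $G$ and an admissible set $S$, an opposition $f$ of $G-S$ is compatible if there is an automorphism $\alpha$ of $G$ of order two such that $\alpha(x)=f(x)$ for all $x\in V(G-S)$. The graph $G$ is compatibly almost opposable if $G-S$ has a compatible opposition for some admissible set $S$. The strong product $G\boxtimes H$ has vertex set $V(G)\times V(H)$, with distinct vertices $(g_1,h_1),(g_2,h_2)$ adjacent iff ($g_1=g_2$ or $g_1g_2\in E(G)$) and ($h_1=h_2$ or $h_1h_2\in E(H)$). -}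

module Defs where

open import Data.Fin using (Fin; zero; suc)
import Data.Fin.Properties as Fin
open import Data.Irrelevant using ([_])
open import Data.Nat using (ℕ; zero; suc)
open import Data.Product using (Σ-syntax; ∃-syntax; _×_; _,_; proj₂)
open import Data.Product.Function.NonDependent.Propositional using (_×-↔_)
open import Data.Product.Properties using (≡-dec)
open import Data.Refinement using (Refinement-syntax; _,_; value)
open import Data.Refinement.Properties using (value-injective)
open import Data.Sum using (_⊎_)
import Data.Sum as Sum
open import Function using (_∘_; _↔_; _⇔_; Inverse; mk↔ₛ′; Bijective)
open import Function.Construct.Composition using (_↔-∘_)
open import Function.Construct.Symmetry using (↔-sym)
open import Function.Properties.Inverse using (↔⇒↣)
open import Level using (0ℓ)
open import Relation.Binary using (Rel; Symmetric; DecidableEquality)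
import Relation.Binary as Binary
open import Relation.Binary.PropositionalEquality using (_≡_; _≢_; refl; sym; cong; subst)
open import Relation.Nullary using (¬_; yes; no)
open import Relation.Nullary.Decidable using (_×-dec_; _⊎-dec_; ¬?; via-injection; recompute)
open import Relation.Unary using (Pred; Decidable; _∈_; _∉_; _⊆_)

Finite : Set → Set
Finite A = ∃[ n ] (A ↔ Fin n)

record Graph : Set₁ where
  field
    Vertex  : Set
    Adj     : Rel Vertex 0ℓ
    finite  : Finite Vertex
    adj?    : Binary.Decidable Adj
    symm    : Symmetric Adj
    irrefl  : ∀ {v} → ¬ Adj v v

  _≟_ : DecidableEquality Vertex
  _≟_ = via-injection (↔⇒↣ (proj₂ finite)) Fin._≟_

open Graph public using (Vertex; Adj)

private
  refine-Fin : ∀ {n} {P : Pred (Fin n) 0ℓ} → Decidable P → Finite [ i ∈ Fin n ∣ P i ]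
  refine-Fin {zero} P? = zero , mk↔ₛ′ (λ { (() , _) }) (λ ()) (λ ()) (λ { (() , _) })
  refine-Fin {suc n} {P} P? with P? zero | refine-Fin (P? ∘ suc)
  ... | yes p₀ | k , e = suc k , mk↔ₛ′ to from to∘from from∘to
    where
    to : [ i ∈ Fin (suc n) ∣ P i ] → Fin (suc k)
    to (zero  , _) = zero
    to (suc i , p) = suc (Inverse.to e (i , p))
    from : Fin (suc k) → [ i ∈ Fin (suc n) ∣ P i ]
    from zero = zero , [ p₀ ]
    from (suc j) with Inverse.from e j
    ... | i , p = suc i , p
    to∘from : ∀ j → to (from j) ≡ j
    to∘from zero    = refl
    to∘from (suc j) = cong suc (Inverse.strictlyInverseˡ e j)
    from∘to : ∀ x → from (to x) ≡ x
    from∘to (zero  , _) = refl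
    from∘to (suc i , p) =
      value-injective (cong (suc ∘ value) (Inverse.strictlyInverseʳ e (i , p)))
  ... | no ¬p₀ | k , e = k , mk↔ₛ′ to from to∘from from∘to
    where
    to : [ i ∈ Fin (suc n) ∣ P i ] → Fin k
    to (zero  , [ p ]) with () ← ¬p₀ (recompute (P? zero) p)
    to (suc i , p)     = Inverse.to e (i , p)
    from : Fin k → [ i ∈ Fin (suc n) ∣ P i ]
    from j with Inverse.from e j
    ... | i , p = suc i , p
    to∘from : ∀ j → to (from j) ≡ j
    to∘from j = Inverse.strictlyInverseˡ e j
    from∘to : ∀ x → from (to x) ≡ x
    from∘to (zero  , [ p ]) with () ← ¬p₀ (recompute (P? zero) p)
    from∘to (suc i , p) =
      value-injective (cong (suc ∘ value) (Inverse.strictlyInverseʳ e (i , p)))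

  refine-finite : ∀ {A : Set} {P : Pred A 0ℓ} → Finite A → Decidable P →
                  Finite [ x ∈ A ∣ P x ]
  refine-finite {A} {P} (n , e) P? with refine-Fin (P? ∘ Inverse.from e)
  ... | k , e′ = k , (e′ ↔-∘ mk↔ₛ′ to from to∘from from∘to)
    where
    open Inverse e using (strictlyInverseˡ; strictlyInverseʳ)
    to : [ x ∈ A ∣ P x ] → [ i ∈ Fin n ∣ P (Inverse.from e i) ]
    to (x , [ p ]) = Inverse.to e x , [ subst P (sym (strictlyInverseʳ x)) p ]
    from : [ i ∈ Fin n ∣ P (Inverse.from e i) ] → [ x ∈ A ∣ P x ]
    from (i , [ p ]) = Inverse.from e i , [ p ]
    to∘from : ∀ y → to (from y) ≡ y
    to∘from (i , _) = value-injective (strictlyInverseˡ i)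
    from∘to : ∀ x → from (to x) ≡ x
    from∘to (x , _) = value-injective (strictlyInverseʳ x)

N[_,_] : (G : Graph) → Vertex G → Pred (Vertex G) 0ℓ
N[ G , v ] u = u ≡ v ⊎ Adj G v u

-- A set of vertices is a decidable predicate S, and the vertices of G − S are
-- paired with an irrelevant proof of v ∉ S, so that they are equal exactly when
-- they are equal as vertices of G.
infixl 6 _−_
_−_ : (G : Graph) {S : Pred (Vertex G) 0ℓ} → Decidable S → Graph
_−_ G {S} S? = record
  { Vertex  = [ v ∈ Vertex G ∣ v ∉ S ]
  ; Adj     = λ u v → Adj G (value u) (value v)
  ; finite  = refine-finite (Graph.finite G) (¬? ∘ S?)
  ; adj?    = λ u v → Graph.adj? G (value u) (value v)
  ; symm    = Graph.symm G
  ; irrefl  = Graph.irrefl G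
  }

infixr 7 _⊠_
_⊠_ : Graph → Graph → Graph
G ⊠ H = record
  { Vertex  = Vertex G × Vertex H
  ; Adj     = λ (g₁ , h₁) (g₂ , h₂) →
                (g₁ , h₁) ≢ (g₂ , h₂) × (g₁ ≡ g₂ ⊎ Adj G g₁ g₂) × (h₁ ≡ h₂ ⊎ Adj H h₁ h₂)
  ; finite  = _ , (↔-sym Fin.*↔× ↔-∘ (proj₂ G.finite ×-↔ proj₂ H.finite))
  ; adj?    = λ (g₁ , h₁) (g₂ , h₂) →
                ¬? (≡-dec G._≟_ H._≟_ (g₁ , h₁) (g₂ , h₂))
                ×-dec (g₁ G.≟ g₂ ⊎-dec G.adj? g₁ g₂)
                ×-dec (h₁ H.≟ h₂ ⊎-dec H.adj? h₁ h₂)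
  ; symm    = λ (p≢q , g , h) → p≢q ∘ sym , Sum.map sym G.symm g , Sum.map sym H.symm h
  ; irrefl  = λ (p≢p , _) → p≢p refl
  }
  where
  module G = Graph G
  module H = Graph H

record IsAutomorphism (G : Graph) (f : Vertex G → Vertex G) : Set where
  field
    bijective : Bijective _≡_ _≡_ f
    adj-⇔     : ∀ u v → Adj G u v ⇔ Adj G (f u) (f v)

-- The identity is allowed.
record IsAutomorphismOfOrderTwo (G : Graph) (f : Vertex G → Vertex G) : Set where
  field
    isAutomorphism : IsAutomorphism G f
    involutive     : ∀ v → f (f v) ≡ v

record IsOpposition (G : Graph) (f : Vertex G → Vertex G) : Set where
  field
    isAutomorphismOfOrderTwo : IsAutomorphismOfOrderTwo G f
    opposes                  : ∀ v → f v ∉ N[ G , v ]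

Admissible : (G : Graph) → Pred (Vertex G) 0ℓ → Set
Admissible G S = ∃[ u ] (u ∈ S × S ⊆ N[ G , u ])

Compatible : (G : Graph) {S : Pred (Vertex G) 0ℓ} (S? : Decidable S) →
             (Vertex (G − S?) → Vertex (G − S?)) → Set
Compatible G S? f =
  ∃[ α ] (IsAutomorphismOfOrderTwo G α × (∀ x → α (value x) ≡ value (f x)))

CompatiblyAlmostOpposable : Graph → Set₁
CompatiblyAlmostOpposable G =
  Σ[ S ∈ Pred (Vertex G) 0ℓ ] Σ[ S? ∈ Decidable S ]
    (Admissible G S × ∃[ f ] (IsOpposition (G − S?) f × Compatible G S? f))

{-# OPTIONS --safe #-}

-- A compatible opposition of G − S is the same thing as an automorphism α of G
-- of order two that, outside S, stays outside S and moves v out of N[v].  If α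
-- and β are such automorphisms for (G, S) and (H, T), then α × β is one for
-- (G ⊠ H, S × T): closed neighbourhoods in G ⊠ H are products of closed
-- neighbourhoods, so it suffices that one coordinate leaves its neighbourhood.

module Submission where

open import Defs
open import Data.Irrelevant using ([_])
open import Data.Product using (∃-syntax; _×_; _,_; proj₁; proj₂; map)
open import Data.Product.Properties using (≡-dec)
open import Data.Refinement using (_,_; value)
open import Data.Refinement.Properties using (value-injective)
open import Data.Sum using (inj₁; inj₂)
import Data.Sum as Sum
open import Function using (_∘_; mk⇔; Equivalence)
open import Function.Consequences.Propositional
  using (inverseᵇ⇒bijective; strictlyInverseˡ⇒inverseˡ; strictlyInverseʳ⇒inverseʳ)
open import Level using (0ℓ)
open import Relation.Binary.PropositionalEquality
  using (_≡_; refl; sym; trans; cong; cong₂; subst; subst₂)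
open import Relation.Nullary using (yes; no)
open import Relation.Nullary.Recomputable using (¬-recompute)
open import Relation.Unary using (Pred; Decidable; _∉_; _⊆_; _⟨×⟩_)
open import Relation.Unary.Properties using (_×?_)

module Order2 {G : Graph} {f : Vertex G → Vertex G} (f-order2 : IsAutomorphismOfOrderTwo G f) where
  open IsAutomorphismOfOrderTwo f-order2 public
  open IsAutomorphism isAutomorphism public

  preserves-Adj : ∀ u v → Adj G u v → Adj G (f u) (f v)
  preserves-Adj u v = Equivalence.to (adj-⇔ u v)

-- An involution is its own inverse, hence bijective, and it reflects adjacency because preservation
-- can be applied once more to the images.
involution⇒automorphismOfOrderTwo : ∀ {G f} → (∀ v → f (f v) ≡ v) →
  (∀ u v → Adj G u v → Adj G (f u) (f v)) → IsAutomorphismOfOrderTwo G f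
involution⇒automorphismOfOrderTwo {G} {f} inv pres = record
  { isAutomorphism = record
    { bijective = inverseᵇ⇒bijective
        (strictlyInverseˡ⇒inverseˡ f inv , strictlyInverseʳ⇒inverseʳ f inv)
    ; adj-⇔ = λ u v → mk⇔ (pres u v) (subst₂ (Adj G) (inv u) (inv v) ∘ pres (f u) (f v))
    }
  ; involutive = inv
  }

-- Phrased with a map on all of `G`: the complement of `S × T` contains pairs with one coordinate in
-- `S` or in `T`, where a product of oppositions of `G − S` and `H − T` would be undefined.
OpposesOutside : (G : Graph) → Pred (Vertex G) 0ℓ → (Vertex G → Vertex G) → Set
OpposesOutside G S α = ∀ v → v ∉ S → α v ∉ S × α v ∉ N[ G , v ]

module _ (G : Graph) {S : Pred (Vertex G) 0ℓ} (S? : Decidable S) where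

  compatible⇒opposesOutside : ∀ {f α} → IsOpposition (G − S?) f →
    (∀ x → α (value x) ≡ value (f x)) → OpposesOutside G S α
  compatible⇒opposesOutside {f} {α} opp α≗f v v∉S = αv∉S , αv∉N
    where
    x : Vertex (G − S?)
    x = v , [ v∉S ]

    -- The stored proof is irrelevant, but a negation can always be recomputed.
    value∉S : (y : Vertex (G − S?)) → value y ∉ S
    value∉S (y , [ y∉S ]) = ¬-recompute y∉S

    αv∉S : α v ∉ S
    αv∉S = subst (_∉ S) (sym (α≗f x)) (value∉S (f x))

    αv∉N : α v ∉ N[ G , v ]
    -- Adjacency in `G − S` is that of `G`; only the equality case has to be lifted to refined
    -- vertices.
    αv∉N = IsOpposition.opposes opp x
      ∘ Sum.map₁ value-injective
      ∘ subst N[ G , v ] (α≗f x)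

  -- Since `α` maps the complement of `S` into itself, it restricts to `G − S`, and `α` itself
  -- witnesses compatibility of the restriction.
  opposesOutside⇒compatible : ∀ {α} → IsAutomorphismOfOrderTwo G α → OpposesOutside G S α →
    ∃[ f ] (IsOpposition (G − S?) f × Compatible G S? f)
  opposesOutside⇒compatible {α} α-order2 opp = f , f-opposition , α , α-order2 , λ _ → refl
    where
    open Order2 α-order2

    f : Vertex (G − S?) → Vertex (G − S?)
    f (v , [ v∉S ]) = α v , [ proj₁ (opp v v∉S) ]

    f-opposition : IsOpposition (G − S?) f
    f-opposition = record
      { isAutomorphismOfOrderTwo = involution⇒automorphismOfOrderTwo
          (λ x → value-injective (involutive (value x)))
          (λ x y → preserves-Adj (value x) (value y))
      ; opposes = λ { (v , [ v∉S ]) →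
          proj₂ (opp v (¬-recompute v∉S)) ∘ Sum.map₁ (cong value) }
      }

module _ (G H : Graph) where

  N-⊠ : ∀ {g h} → (N[ G , g ] ⟨×⟩ N[ H , h ]) ⊆ N[ G ⊠ H , (g , h) ]
  N-⊠ {g} {h} {g′ , h′} (g′∈N , h′∈N)
    -- Adjacency in `G ⊠ H` demands distinct vertices, so the centre has to be split off first.
    with ≡-dec (Graph._≟_ G) (Graph._≟_ H) (g , h) (g′ , h′)
  ... | yes eq = inj₁ (sym eq)
  ... | no neq = inj₂ (neq , Sum.map₁ sym g′∈N , Sum.map₁ sym h′∈N)

  N-⊠⁻¹ : ∀ {g h} → N[ G ⊠ H , (g , h) ] ⊆ (N[ G , g ] ⟨×⟩ N[ H , h ])
  N-⊠⁻¹ (inj₁ refl)           = inj₁ refl , inj₁ refl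
  N-⊠⁻¹ (inj₂ (_ , g~ , h~)) = Sum.map₁ sym g~ , Sum.map₁ sym h~

  admissible-⊠ : ∀ {S T} → Admissible G S → Admissible H T → Admissible (G ⊠ H) (S ⟨×⟩ T)
  admissible-⊠ (u , u∈S , S⊆N) (v , v∈T , T⊆N) =
    (u , v) , (u∈S , v∈T) , λ (g∈S , h∈T) → N-⊠ (S⊆N g∈S , T⊆N h∈T)

  automorphismOfOrderTwo-⊠ : ∀ {α β} →
    IsAutomorphismOfOrderTwo G α → IsAutomorphismOfOrderTwo H β →
    IsAutomorphismOfOrderTwo (G ⊠ H) (map α β)
  automorphismOfOrderTwo-⊠ {α} {β} α-order2 β-order2 =
    involution⇒automorphismOfOrderTwo involutive
      λ { (g , h) (g′ , h′) (neq , g~ , h~) →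
        -- Distinctness survives because applying the involution to equal images recovers the
        -- original vertices.
        (λ eq → neq (trans (sym (involutive _)) (trans (cong (map α β) eq) (involutive _)))) ,
        Sum.map (cong α) (A.preserves-Adj g g′) g~ ,
        Sum.map (cong β) (B.preserves-Adj h h′) h~ }
    where
    module A = Order2 α-order2
    module B = Order2 β-order2

    involutive : ∀ p → map α β (map α β p) ≡ p
    involutive (g , h) = cong₂ _,_ (A.involutive g) (B.involutive h)

  -- A pair outside `S × T` has `g ∉ S`, or else `g ∈ S` and then `h ∉ T`. The coordinate found this
  -- way keeps the image out of both `S × T` and the closed neighbourhood.
  opposesOutside-⊠ : ∀ {S T α β} → Decidable S →
    OpposesOutside G S α → OpposesOutside H T β → OpposesOutside (G ⊠ H) (S ⟨×⟩ T) (map α β)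
  opposesOutside-⊠ S? oppG oppH (g , h) gh∉S×T with S? g
  ... | no g∉S with αg∉S , αg∉N ← oppG g g∉S =
    (λ (αg∈S , _) → αg∉S αg∈S) , λ n → αg∉N (proj₁ (N-⊠⁻¹ n))
  ... | yes g∈S with βh∉T , βh∉N ← oppH h (λ h∈T → gh∉S×T (g∈S , h∈T)) =
    (λ (_ , βh∈T) → βh∉T βh∈T) , λ n → βh∉N (proj₂ (N-⊠⁻¹ n))

theorem4p4 : (G H : Graph) → CompatiblyAlmostOpposable G → CompatiblyAlmostOpposable H → CompatiblyAlmostOpposable (G ⊠ H)
theorem4p4 G H (S , S? , S-adm , f , f-opp , α , α-order2 , α≗f)
               (T , T? , T-adm , k , k-opp , β , β-order2 , β≗k) =
  (S ⟨×⟩ T) , (S? ×? T?) , admissible-⊠ G H S-adm T-adm ,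
  opposesOutside⇒compatible (G ⊠ H) (S? ×? T?)
    (automorphismOfOrderTwo-⊠ G H α-order2 β-order2)
    (opposesOutside-⊠ G H S?
      (compatible⇒opposesOutside G S? f-opp α≗f)
      (compatible⇒opposesOutside H T? k-opp β≗k))
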